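{- There is an absolute constant $a>0$ such that the following holds. For every $n$, every integer $D$ with $1\le D\le n/6$, and every DB protocol $P$ (which may depend on $n$, i.e. every node may know $n$), there exists an $n$-node directed graph $G^P$ with a source, of maximum eccentricity $D$, such that $P$ does not complete broadcasting on $G^P$ in fewer than $a\,n\log_2 D$ time-slots.
   Context: A (radio) network is a directed graph whose $n$ nodes have distinct labels in $[n]=\{1,\dots,n\}$; an edge $(u,v)$ means $u$ can transmit to $v$ in one hop. One node $s$, the source, initially holds the source message, and every node is reachable from $s$. A deterministic distributed broadcast (DB) protocol works in time-slots $0,1,2,\dots$ as follows. (1) In the initial time-slot the source transmits the source message. (2) In each time-slot each node acts as a transmitter (sending one message, of arbitrary size, along all its outgoing edges), or as a receiver, or is non active. (3) A node receives a message in a time-slot if and only if it acts as a receiver and exactly one of its in-neighbours acts as a transmitter in that slot; otherwise it receives nothing and cannot distinguish a collision from silence. (4) The action of a node in a time-slot is a function of its own label, the number of the current slot, and the messages it received in previous slots (the source also knows that it is the source and knows the source message); nodes have no other knowledge of the network beyond what is explicitly stated. Nodes may transmit before having received any message. The protocol has completed broadcasting when all nodes reachable from the source have received the source message. The eccentricity of a node from which all nodes are reachable is its largest distance to a node of the network; the maximum eccentricity $D$ is the maximum over all possible source nodes (nodes from which every node is reachable). -}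

module Defs where

open import Data.Nat.Base using (ℕ; zero; suc; _≤_; _<_; _*_; _^_)
open import Data.Integer.Base using (∣_∣)
open import Data.Rational.Base using (ℚ; ↥_; ↧ₙ_)
open import Data.Fin.Base using (Fin)
open import Data.Fin.Properties using (_≟_)
open import Data.List.Base using (List; []; _∷_; allFin; filter; mapMaybe)
open import Data.Maybe.Base as Maybe using (Maybe; just; nothing)
open import Data.Product.Base using (_×_; _,_; proj₂; ∃; ∃-syntax)
open import Data.Vec.Base using (Vec; []; _∷_)
open import Level using (0ℓ)
open import Relation.Binary.Core using (Rel)
open import Relation.Binary.Definitions using (Decidable)
open import Relation.Binary.Construct.Closure.ReflexiveTransitive using (Star; ε; _◅_)
open import Relation.Binary.PropositionalEquality.Core using (_≡_)
open import Relation.Nullary.Decidable.Core using (does)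
open import Data.Bool.Base using (if_then_else_)

-- The label i of [n] is represented by the element i - 1 of Fin n; since the
-- n labels are distinct, nodes are identified with their labels.
record Digraph (n : ℕ) : Set₁ where
  field
    _⟶_  : Rel (Fin n) 0ℓ
    _⟶?_ : Decidable _⟶_

  IsSource : Fin n → Set
  IsSource s = ∀ v → Star _⟶_ s v

record Network (n : ℕ) : Set₁ where
  field
    graph    : Digraph n
    source   : Fin n
    isSource : Digraph.IsSource graph source

  open Digraph graph public

IsMaximum : (ℕ → Set) → ℕ → Set
IsMaximum P m = P m × (∀ k → P k → k ≤ m)

module _ {n : ℕ} (G : Digraph n) where
  open Digraph G

  length : ∀ {u v} → Star _⟶_ u v → ℕ
  length ε        = 0
  length (_ ◅ es) = suc (length es)

  Distance : Fin n → Fin n → ℕ → Set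
  Distance u v d = (∃[ p ] length {u} {v} p ≡ d) × (∀ p → d ≤ length {u} {v} p)

  Eccentricity : Fin n → ℕ → Set
  Eccentricity u = IsMaximum (λ d → ∃[ v ] Distance u v d)

  MaxEccentricity : ℕ → Set
  MaxEccentricity = IsMaximum (λ e → ∃[ u ] IsSource u × Eccentricity u e)

data Action (M : Set) : Set where
  transmit : M → Action M
  receive  : Action M
  inactive : Action M

-- In  act v k t h :  v is the node's own label; k is  just σ  at the source,
-- where σ is the source message, and  nothing  at every other node; t is the
-- current slot; h records, most recent slot first, the message received in
-- each of the slots 0, …, t - 1, with  nothing  for a slot in which no message
-- was received.
record Protocol (M : Set) (n : ℕ) : Set where
  field
    act     : Fin n → Maybe M → (t : ℕ) → Vec (Maybe M) t → Action M
    initial : ∀ v σ → act v (just σ) 0 [] ≡ transmit σ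

transmitted : ∀ {M} → Action M → Maybe M
transmitted (transmit m) = just m
transmitted receive      = nothing
transmitted inactive     = nothing

unique : ∀ {A : Set} → List A → Maybe A
unique (x ∷ []) = just x
unique _        = nothing

module Execution {M n} (P : Protocol M n) (N : Network n) (σ : M) where
  open Protocol P
  open Network N

  incoming : (Fin n → Action M) → Fin n → List (Fin n × M)
  incoming acts v =
    mapMaybe (λ u → Maybe.map (u ,_) (transmitted (acts u)))
             (filter (_⟶? v) (allFin n))

  -- The message received by v in a slot with the given actions, paired with
  -- its sender.  The sender is used only in the definition of Informed; it is
  -- not disclosed to v.
  reception : (Fin n → Action M) → Fin n → Maybe (Fin n × M)
  reception acts v with acts v
  ... | receive    = unique (incoming acts v)
  ... | transmit _ = nothing
  ... | inactive   = nothing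

  history : (t : ℕ) → Fin n → Vec (Maybe M) t
  action  : ℕ → Fin n → Action M

  history zero    v = []
  history (suc t) v = Maybe.map proj₂ (reception (action t) v) ∷ history t v

  action t v = act v (if does (v ≟ source) then just σ else nothing) t (history t v)

  -- Informed t v: after the slots 0, …, t - 1, node v has the source message.
  -- Messages have arbitrary size, so a node that has the source message can
  -- append it to everything it sends; hence every message sent by such a node
  -- counts as containing the source message.  A node that does not have it
  -- cannot pass it on, whatever element of M it happens to send.
  data Informed : ℕ → Fin n → Set where
    origin   : ∀ {t} → Informed t source
    retained : ∀ {t v} → Informed t v → Informed (suc t) v
    received : ∀ {t u v m} → Informed t u →
               reception (action t) v ≡ just (u , m) → Informed (suc t) v

  CompletedWithin : ℕ → Set
  CompletedWithin T = ∀ v → Star _⟶_ source v → Informed T v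

-- The real inequality  T < a · n · log₂ D  for a > 0 and D ≥ 1: with
-- a = p / q, multiply by q and exponentiate to base 2, so that it reads
-- 2 ^ (q T) < D ^ (p n).
_<_·_·log₂_ : ℕ → ℚ → ℕ → ℕ → Set
T < a · n ·log₂ D = 2 ^ (↧ₙ a * T) < D ^ (∣ ↥ a ∣ * n)

{-# OPTIONS --safe #-}
module Submission where

-- On a complete layered network, layer j + 1 stays uninformed as long as no
-- slot has exactly one transmitter in layer j.  Once the layers below j are
-- fixed, the behaviour of every remaining label placed on layer j is determined.
-- Select one label from each of k disjoint blocks of b remaining labels.  If
-- b ^ k > 2 ^ Δ, two of the b ^ k selections have transmitter counts of the same
-- parity in each of the next Δ slots, so that their symmetric difference, taken
-- as layer j, has an even number of transmitters in each of these slots.  With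
-- b = 2 D, k = ⌊ n / 4 D ⌋ and Δ = k ⌊ log₂ D ⌋ the labels suffice for D - 1
-- such layers, and (D - 1) Δ ≥ n log₂ D / 32.

open import Defs
open import Algebra.Bundles using (CommutativeRing)
import Algebra.Properties.CommutativeSemigroup as CommutativeSemigroupProperties
open import Data.Bool.Base using (Bool; true; false; _∧_; _xor_; if_then_else_)
open import Data.Bool.Properties as Bool using (∧-distribʳ-xor; xor-same; xor-∧-commutativeRing)
open import Data.Fin.Base
  using (Fin; zero; suc; toℕ; fromℕ<; combine; quotient; remainder; inject≤; finToFun; funToFin)
open import Data.Fin.Properties as Fin
  using (_≟_; any?; pigeonhole; finToFun-funToFin; combine-remQuot; combine-injective;
         inject≤-injective; toℕ-fromℕ<; ¬∀⟶∃¬; 2↔Bool)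
open import Data.Integer.Base as ℤ using ()
open import Data.List.Base as List
  using (List; []; _∷_; _++_; foldr; filter; mapMaybe; allFin; lookup; tabulate)
open import Data.List.Membership.Propositional using (_∈_; _∉_)
open import Data.List.Membership.Propositional.Properties
  using (∈-++⁺ˡ; ∈-++⁺ʳ; ∈-tabulate⁺; ∈-lookup; ∈-filter⁻)
open import Data.List.Properties using (length-++; length-tabulate; filter-all)
open import Data.List.Relation.Unary.All as All using (All; []; _∷_)
import Data.List.Relation.Unary.All.Properties as All
open import Data.List.Relation.Unary.AllPairs using ([]; _∷_)
open import Data.List.Relation.Unary.Any using (here; there)
open import Data.List.Relation.Unary.Unique.Propositional using (Unique)
import Data.List.Relation.Unary.Unique.Propositional.Properties as Unique
open import Data.Maybe.Base as Maybe using (Maybe; just; nothing; is-just)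
open import Data.Nat.Base
  using (ℕ; zero; suc; _+_; _*_; _∸_; _^_; _≤_; _<_; pred; z≤n; s≤s; s≤s⁻¹; NonZero; >-nonZero)
open import Data.Nat.Coprimality using (1-coprimeTo)
open import Data.Nat.DivMod using (_/_; _%_; m/n*n≤m; m≡m%n+[m/n]*n; m%n<n; m≥n⇒m/n>0)
open import Data.Nat.Properties as ℕ using (≤-trans; ≤-reflexive)
open import Data.Nat.Tactic.RingSolver using (solve-∀)
open import Data.Product.Base using (_×_; _,_; proj₁; proj₂; ∃; ∃₂; Σ-syntax; ∃-syntax)
open import Data.Rational.Base as ℚ using (ℚ; 0ℚ; mkℚ) renaming (_<_ to _<ℚ_)
open import Data.Vec.Base using () renaming (_∷_ to _∷ᵛ_)
open import Function.Base using (_∘_)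
open import Function.Bundles using (Inverse)
open import Relation.Binary.Construct.Closure.ReflexiveTransitive using (Star; ε; _◅_; _◅◅_)
open import Relation.Binary.PropositionalEquality
open import Relation.Nullary.Decidable using (Dec; yes; no; does; ¬?; dec-true; dec-false)
open import Relation.Nullary.Negation.Core using (¬_; contradiction)

-- Parities and a pigeonhole principle for selections.

private
  variable
    A B : Set

-- An even count is never one, and parity is additive; this makes "not exactly one transmitter"
-- tractable.
parity : List A → (A → Bool) → Bool
parity xs f = foldr (λ x b → f x xor b) false xs

module _ where
  open CommutativeSemigroupProperties (CommutativeRing.+-commutativeSemigroup xor-∧-commutativeRing)

  parity-xor : ∀ (xs : List A) (f g : A → Bool) →
               parity xs (λ x → f x xor g x) ≡ parity xs f xor parity xs g
  parity-xor []       f g = refl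
  parity-xor (x ∷ xs) f g = trans (cong ((f x xor g x) xor_) (parity-xor xs f g))
                                  (interchange (f x) (g x) (parity xs f) (parity xs g))

parity-cong : ∀ (xs : List A) {f g : A → Bool} → f ≗ g → parity xs f ≡ parity xs g
parity-cong []       f≗g = refl
parity-cong (x ∷ xs) f≗g = cong₂ _xor_ (f≗g x) (parity-cong xs f≗g)

-- Assuming only pointwise equality stands in for function extensionality; the code is recovered
-- digit by digit from quotient and remainder.
finToFun-injective : ∀ b k (x y : Fin (b ^ k)) → finToFun {b} {k} x ≗ finToFun {b} {k} y → x ≡ y
finToFun-injective b zero    zero zero eq = refl
finToFun-injective b (suc k) x y eq = begin
  x                                      ≡⟨ combine-remQuot {b} (b ^ k) x ⟨
  combine (quotient {b} (b ^ k) x) (remainder {b} (b ^ k) x)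
    ≡⟨ cong₂ combine (eq zero) (finToFun-injective b k _ _ (eq ∘ suc)) ⟩
  combine (quotient {b} (b ^ k) y) (remainder {b} (b ^ k) y)
                                         ≡⟨ combine-remQuot {b} (b ^ k) y ⟩
  y                                      ∎
  where open ≡-Reasoning

-- Number the selections below `b ^ k` and the outcomes below `2 ^ Δ`. An explicit index of
-- disagreement is returned because it later makes the symmetric difference nonempty.
pigeonhole-functions : ∀ {k b Δ} → 2 ^ Δ < b ^ k → (F : (Fin k → Fin b) → Fin Δ → Bool) →
                       ∃₂ λ f g → (∃ λ i → f i ≢ g i) × F f ≗ F g
pigeonhole-functions {k} {b} {Δ} lt F
  with x , y , x<y , eq ← pigeonhole lt
         (λ x → funToFin (λ s → Inverse.from 2↔Bool (F (finToFun x) s)))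
  with f≢g ← ¬∀⟶∃¬ k _ (λ i → finToFun {b} {k} x i ≟ finToFun {b} {k} y i)
         (λ f≗g → ℕ.<-irrefl (cong toℕ (finToFun-injective b k x y f≗g)) x<y)
  = finToFun x , finToFun y , f≢g , λ s → from-injective (begin
      from (F (finToFun x) s)                  ≡⟨ finToFun-funToFin _ s ⟨
      finToFun (funToFin {Δ} {2} (λ s → from (F (finToFun x) s))) s
                                               ≡⟨ cong (λ z → finToFun {2} {Δ} z s) eq ⟩
      finToFun (funToFin {Δ} {2} (λ s → from (F (finToFun y) s))) s
                                               ≡⟨ finToFun-funToFin _ s ⟩
      from (F (finToFun y) s)                  ∎)
  where
  open ≡-Reasoning
  open Inverse 2↔Bool using (from)
  from-injective : ∀ {x y} → from x ≡ from y → x ≡ y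
  from-injective {true}  {true}  _ = refl
  from-injective {false} {false} _ = refl

-- Symmetric difference of two selections from disjoint blocks.

module Selection {n k b : ℕ} (e : Fin k → Fin b → Fin n)
  (e-injective : ∀ {i i′ x x′} → e i x ≡ e i′ x′ → i ≡ i′ × x ≡ x′) where

  chosen : (Fin k → Fin b) → Fin n → Bool
  chosen f u = does (any? (λ i → e i (f i) ≟ u))

  chosen-e : ∀ f i → chosen f (e i (f i)) ≡ true
  chosen-e f i = dec-true (any? _) (i , refl)

  chosen⁻ : ∀ f u → chosen f u ≡ true → ∃ λ i → e i (f i) ≡ u
  chosen⁻ f u eq with yes p ← any? (λ i → e i (f i) ≟ u) = p

  -- Blocks are disjoint, so `g` could select this label only from block `i`, where it selects
  -- another one.
  unchosen : ∀ (f g : Fin k → Fin b) {i} → f i ≢ g i → chosen g (e i (f i)) ≡ false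
  unchosen f g {i} f≢g with any? (λ i′ → e i′ (g i′) ≟ e i (f i))
  ... | no  _         = refl
  ... | yes (_ , eq) with refl , gi≡fi ← e-injective eq = contradiction (sym gi≡fi) f≢g

  -- `S` is the symmetric difference of two colliding selections, so its count is, modulo 2, the sum
  -- of two equal parities. `ys` concatenates both selections; it may repeat labels, yet its length
  -- bounds how many are used up.
  even-selection : ∀ {Δ} → 2 ^ Δ < b ^ k → (a : Fin Δ → Fin n → Bool) →
    Σ[ S ∈ (Fin n → Bool) ] Σ[ ys ∈ List (Fin n) ]
      List.length ys ≡ k + k ×
      All (λ u → ∃₂ λ i x → e i x ≡ u) ys ×
      (∀ u → S u ≡ true → u ∈ ys) ×
      (∃ λ u → S u ≡ true) ×
      (∀ s → parity (allFin n) (λ u → S u ∧ a s u) ≡ false)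
  even-selection {Δ} lt a
    with f , g , (i , f≢g) , eq ← pigeonhole-functions lt
           (λ f s → parity (allFin n) (λ u → chosen f u ∧ a s u))
    = S , ys f ++ ys g , length-ys , All.++⁺ (all-ys f) (all-ys g) , S⊆ys ,
      (e i (f i) , cong₂ _xor_ (chosen-e f i) (unchosen f g f≢g)) , even
    where
    S : Fin n → Bool
    S u = chosen f u xor chosen g u

    ys : (Fin k → Fin b) → List (Fin n)
    ys f = tabulate (λ i → e i (f i))

    length-ys : List.length (ys f ++ ys g) ≡ k + k
    length-ys = trans (length-++ (ys f))
                      (cong₂ _+_ (length-tabulate (λ i → e i (f i))) (length-tabulate (λ i → e i (g i))))

    all-ys : ∀ f → All (λ u → ∃₂ λ i x → e i x ≡ u) (ys f)
    all-ys f = All.tabulate⁺ (λ i → i , f i , refl)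

    ∈-ys : ∀ f u → chosen f u ≡ true → u ∈ ys f
    ∈-ys f u eq with i , refl ← chosen⁻ f u eq = ∈-tabulate⁺ {f = λ i → e i (f i)} i

    S⊆ys : ∀ u → S u ≡ true → u ∈ ys f ++ ys g
    S⊆ys u eq with chosen f u in eqf
    ... | true  = ∈-++⁺ˡ (∈-ys f u eqf)
    ... | false = ∈-++⁺ʳ (ys f) (∈-ys g u eq)

    even : ∀ s → parity (allFin n) (λ u → S u ∧ a s u) ≡ false
    even s = begin
      parity (allFin n) (λ u → S u ∧ a s u)
        ≡⟨ parity-cong (allFin n) (λ u → ∧-distribʳ-xor (a s u) (chosen f u) (chosen g u)) ⟩
      parity (allFin n) (λ u → (chosen f u ∧ a s u) xor (chosen g u ∧ a s u))
        ≡⟨ parity-xor (allFin n) (λ u → chosen f u ∧ a s u) (λ u → chosen g u ∧ a s u) ⟩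
      parity (allFin n) (λ u → chosen f u ∧ a s u) xor parity (allFin n) (λ u → chosen g u ∧ a s u)
        ≡⟨ cong (parity (allFin n) (λ u → chosen f u ∧ a s u) xor_) (eq s) ⟨
      parity (allFin n) (λ u → chosen f u ∧ a s u) xor parity (allFin n) (λ u → chosen f u ∧ a s u)
        ≡⟨ xor-same (parity (allFin n) (λ u → chosen f u ∧ a s u)) ⟩
      false ∎
      where open ≡-Reasoning

-- Deleting labels from a list without duplicates.

remove : ∀ {n} → Fin n → List (Fin n) → List (Fin n)
remove u = filter (λ x → ¬? (u ≟ x))

_without_ : ∀ {n} → List (Fin n) → List (Fin n) → List (Fin n)
xs without ys = foldr remove xs ys

module _ {n : ℕ} where

  -- `u` occurs at most once, so at most one entry is filtered out.
  length-remove : ∀ (u : Fin n) {xs} → Unique xs → List.length xs ≤ suc (List.length (remove u xs))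
  length-remove u []          = z≤n
  length-remove u {x ∷ xs} (x∉xs ∷ xs!) with u ≟ x
  ... | yes refl = s≤s (≤-reflexive (cong List.length (sym (filter-all _ x∉xs))))
  ... | no  _    = s≤s (length-remove u xs!)

  without-unique : ∀ {xs : List (Fin n)} ys → Unique xs → Unique (xs without ys)
  without-unique []       xs! = xs!
  without-unique (y ∷ ys) xs! = Unique.filter⁺ _ (without-unique ys xs!)

  length-without : ∀ {xs : List (Fin n)} ys → Unique xs →
                   List.length xs ≤ List.length ys + List.length (xs without ys)
  length-without []       xs! = ℕ.≤-refl
  length-without {xs} (y ∷ ys) xs! = begin
    List.length xs
      ≤⟨ length-without ys xs! ⟩
    List.length ys + List.length (xs without ys)
      ≤⟨ ℕ.+-monoʳ-≤ (List.length ys) (length-remove y (without-unique ys xs!)) ⟩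
    List.length ys + suc (List.length (xs without (y ∷ ys)))
      ≡⟨ ℕ.+-suc (List.length ys) _ ⟩
    suc (List.length ys + List.length (xs without (y ∷ ys))) ∎
    where open ℕ.≤-Reasoning

  without⁻ : ∀ {xs : List (Fin n)} ys {u} → u ∈ xs without ys → u ∈ xs × u ∉ ys
  without⁻ []       u∈ = u∈ , λ ()
  without⁻ {xs} (y ∷ ys) u∈
    with u∈′ , y≢u ← ∈-filter⁻ (λ x → ¬? (y ≟ x)) {xs = xs without ys} u∈
    with u∈xs , u∉ys ← without⁻ ys u∈′
    = u∈xs , λ where
        (here u≡y)   → y≢u (sym u≡y)
        (there u∈ys) → u∉ys u∈ys

lookup-injective : ∀ {xs : List A} → Unique xs → ∀ {i j} → lookup xs i ≡ lookup xs j → i ≡ j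
lookup-injective (x∉xs ∷ xs!) {zero}  {zero}  eq = refl
lookup-injective (x∉xs ∷ xs!) {zero}  {suc j} eq = contradiction eq (All.lookup x∉xs (∈-lookup j))
lookup-injective (x∉xs ∷ xs!) {suc i} {zero}  eq = contradiction (sym eq) (All.lookup x∉xs (∈-lookup i))
lookup-injective (x∉xs ∷ xs!) {suc i} {suc j} eq = cong suc (lookup-injective xs! eq)

-- Lists of incoming messages.

module _ {p} {P : A → Set p} (P? : ∀ x → Dec (P x)) where

  -- Turns the parity of the length of an `incoming` list into a parity over all labels, the form
  -- that `even-selection` controls.
  parity-mapMaybe-filter : ∀ (h : A → Maybe B) xs →
    parity (mapMaybe h (filter P? xs)) (λ _ → true) ≡ parity xs (λ x → does (P? x) ∧ is-just (h x))
  parity-mapMaybe-filter h []       = refl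
  parity-mapMaybe-filter h (x ∷ xs) with does (P? x)
  ... | false = parity-mapMaybe-filter h xs
  ... | true  with h x
  ...   | nothing = parity-mapMaybe-filter h xs
  ...   | just _  = cong (true xor_) (parity-mapMaybe-filter h xs)

  -- The maps have to agree only where the filter passes, because actions in two networks are
  -- compared only on the in-neighbours of a given receiver.
  mapMaybe-filter-cong : ∀ {q} {Q : A → Set q} (Q? : ∀ x → Dec (Q x)) {h h′ : A → Maybe B} →
    (∀ {x} → P x → Q x × h x ≡ h′ x) → (∀ {x} → Q x → P x) →
    ∀ xs → mapMaybe h (filter P? xs) ≡ mapMaybe h′ (filter Q? xs)
  mapMaybe-filter-cong Q? P⇒Q Q⇒P []       = refl
  mapMaybe-filter-cong Q? {h} {h′} P⇒Q Q⇒P (x ∷ xs) with P? x | Q? x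
  ... | yes Px | no ¬Qx = contradiction (proj₁ (P⇒Q Px)) ¬Qx
  ... | no ¬Px | yes Qx = contradiction (Q⇒P Qx) ¬Px
  ... | no _   | no _   = mapMaybe-filter-cong Q? P⇒Q Q⇒P xs
  ... | yes Px | yes _  with h x | h′ x | proj₂ (P⇒Q Px)
  ...   | nothing | nothing | refl = mapMaybe-filter-cong Q? P⇒Q Q⇒P xs
  ...   | just y  | just _  | refl = cong (y ∷_) (mapMaybe-filter-cong Q? P⇒Q Q⇒P xs)

mapMaybe-filter-All : ∀ {p r} {P : A → Set p} (P? : ∀ x → Dec (P x)) {h : A → Maybe B} {R : B → Set r} →
  (∀ {x y} → P x → h x ≡ just y → R y) → ∀ xs → All R (mapMaybe h (filter P? xs))
mapMaybe-filter-All P? PhR []       = []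
mapMaybe-filter-All P? {h} PhR (x ∷ xs) with P? x
... | no  _  = mapMaybe-filter-All P? PhR xs
... | yes Px with h x in eq
...   | nothing = mapMaybe-filter-All P? PhR xs
...   | just y  = PhR Px eq ∷ mapMaybe-filter-All P? PhR xs

is-just-map : ∀ {f : A → B} x → is-just (Maybe.map f x) ≡ is-just x
is-just-map nothing  = refl
is-just-map (just _) = refl

unique-even : ∀ (xs : List A) → parity xs (λ _ → true) ≡ false → unique xs ≡ nothing
unique-even []          _ = refl
unique-even (_ ∷ _ ∷ _) _ = refl

unique⁻ : ∀ (xs : List A) {x} → unique xs ≡ just x → xs ≡ x ∷ []
unique⁻ (_ ∷ []) refl = refl

-- Complete layered digraphs.

record Layering (n : ℕ) : Set where
  field
    root        : Fin n
    level       : Fin n → ℕ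
    level-root  : level root ≡ 0
    root-unique : ∀ {v} → level v ≡ 0 → v ≡ root
    parent      : ∀ {v i} → level v ≡ suc i → ∃ λ u → level u ≡ i

  graph : Digraph n
  graph = record
    { _⟶_  = λ u v → level v ≡ suc (level u)
    ; _⟶?_ = λ u v → level v ℕ.≟ suc (level u)
    }

  open Digraph graph using (_⟶_; IsSource)

  path : ∀ i v → level v ≡ i → Star _⟶_ root v
  path zero    v eq with refl ← root-unique eq = ε
  path (suc i) v eq with u , eq′ ← parent eq =
    path i u eq′ ◅◅ trans eq (cong suc (sym eq′)) ◅ ε

  network : Network n
  network = record { graph = graph ; source = root ; isSource = λ v → path _ v refl }

  -- Every edge climbs one level, so all paths between two given nodes have the same length.
  length-path : ∀ {u v} (p : Star _⟶_ u v) → level v ≡ length graph p + level u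
  length-path ε = refl
  length-path (_◅_ {j = w} u⟶w p) =
    trans (length-path p) (trans (cong (length graph p +_) u⟶w) (ℕ.+-suc (length graph p) _))

  length-path-root : ∀ {v} (p : Star _⟶_ root v) → level v ≡ length graph p
  length-path-root p = trans (length-path p) (trans (cong (length graph p +_) level-root) (ℕ.+-identityʳ _))

  -- A path length is a difference of levels, hence at most `D` from any starting node; from the
  -- root, `D` is attained.
  maxEccentricity : ∀ {D} → (∀ v → level v ≤ D) → (∃ λ v → level v ≡ D) → MaxEccentricity graph D
  maxEccentricity {D} level≤ (v , eq) =
    (root , Network.isSource network , (v , distance-v) , distance≤) ,
    λ where k (_ , _ , (w , d) , _) → distance≤ k (w , d)
    where
    distance-v : Distance graph root v D
    distance-v = (path _ v refl , trans (sym (length-path-root (path _ v refl))) eq) ,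
                 λ p → ≤-reflexive (trans (sym eq) (length-path-root p))
    distance≤ : ∀ {u} k → (∃ λ w → Distance graph u w k) → k ≤ D
    distance≤ {u} k (w , (p , refl) , _) =
      ≤-trans (ℕ.m≤m+n k (level u)) (≤-trans (≤-reflexive (sym (length-path p))) (level≤ w))

-- Refinement of the top layer.

-- L′ refines L by moving some nodes of level j to higher levels.
record Agreement {n} (j : ℕ) (L L′ : Layering n) : Set where
  private
    module L = Layering L
    module L′ = Layering L′
  field
    root≡ : L′.root ≡ L.root
    below : ∀ {v} → L.level v < j → L′.level v ≡ L.level v
    upto  : ∀ {v} → L′.level v ≤ j → L.level v ≡ L′.level v

  sender≤ : ∀ {u v} → L′.level v ≤ j → L′.level v ≡ suc (L′.level u) → L′.level u ≤ j
  sender≤ v≤j u⟶v = ≤-trans (ℕ.n≤1+n _) (subst (_≤ j) u⟶v v≤j)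

  edge⁻ : ∀ {u v} → L′.level v ≤ j → L′.level v ≡ suc (L′.level u) → L.level v ≡ suc (L.level u)
  edge⁻ v≤j u⟶v = trans (upto v≤j) (trans u⟶v (cong suc (sym (upto (sender≤ v≤j u⟶v)))))

  -- Here the level of `u` is known only in `L`; being one level under `v`, it is strictly less than
  -- `j`, as `below` demands.
  edge⁺ : ∀ {u v} → L′.level v ≤ j → L.level v ≡ suc (L.level u) → L′.level v ≡ suc (L′.level u)
  edge⁺ v≤j u⟶v = trans v≡1+u (cong suc (sym (below (subst (_≤ j) v≡1+u v≤j))))
    where v≡1+u = trans (sym (upto v≤j)) u⟶v

-- A view for case analysis on one refinement of the top layer `i + 1`; `s` tells whether the node
-- belongs to the set kept there.
data Move (i ℓ : ℕ) (s : Bool) (ℓ′ : ℕ) : Set where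
  low    : ℓ ≤ i → ℓ′ ≡ ℓ → Move i ℓ s ℓ′
  kept   : s ≡ true → ℓ ≡ suc i → ℓ′ ≡ suc i → Move i ℓ s ℓ′
  pushed : s ≡ false → ℓ ≡ suc i → ℓ′ ≡ suc (suc i) → Move i ℓ s ℓ′

module Refinement {n} (L : Layering n) {i : ℕ}
  (level≤ : ∀ v → Layering.level L v ≤ suc i) (S : Fin n → Bool)
  (S-top : ∀ {u} → S u ≡ true → Layering.level L u ≡ suc i)
  (S-nonempty : ∃ λ u → S u ≡ true) where

  open Layering L

  moved : ℕ → Bool → ℕ
  moved ℓ true  = ℓ
  moved ℓ false = if does (ℓ ℕ.≟ suc i) then suc (suc i) else ℓ

  moved-top : ∀ {ℓ} → ℓ ≡ suc i → moved ℓ false ≡ suc (suc i)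
  moved-top refl = cong (λ t → if t then suc (suc i) else suc i) (dec-true (suc i ℕ.≟ suc i) refl)

  level′ : Fin n → ℕ
  level′ v = moved (level v) (S v)

  move : ∀ v → Move i (level v) (S v) (level′ v)
  move v with S v in eq
  ... | true  = kept refl (S-top eq) (S-top eq)
  ... | false with level v ℕ.≟ suc i
  ...   | yes top = pushed refl top (moved-top top)
  ...   | no ¬top = low (s≤s⁻¹ (ℕ.≤∧≢⇒< (level≤ v) ¬top))
                       (cong (λ t → if t then suc (suc i) else level v) (dec-false (level v ℕ.≟ suc i) ¬top))

  below : ∀ {v} → level v < suc i → level′ v ≡ level v
  below {v} v<j with move v
  ... | low _ eq        = eq
  ... | kept _ top _   = contradiction top (ℕ.<⇒≢ v<j)
  ... | pushed _ top _ = contradiction top (ℕ.<⇒≢ v<j)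

  upto : ∀ {v} → level′ v ≤ suc i → level v ≡ level′ v
  upto {v} v≤j with move v
  ... | low _ eq        = sym eq
  ... | kept _ top eq   = trans top (sym eq)
  ... | pushed _ _ eq  = contradiction (subst (_≤ suc i) eq v≤j) ℕ.1+n≰n

  level′-kept : ∀ {u} → S u ≡ true → level′ u ≡ suc i
  level′-kept {u} u∈S = trans (cong (moved (level u)) u∈S) (S-top u∈S)

  parent-below : ∀ {v k} → level v ≡ suc k → k ≤ i → ∃ λ u → level′ u ≡ k
  parent-below eq k≤i with u , refl ← parent eq = u , below (s≤s k≤i)

  refined : Layering n
  refined = record
    { root        = root
    ; level       = level′
    ; level-root  = trans (below (s≤s (≤-trans (≤-reflexive level-root) z≤n))) level-root
    ; root-unique = λ eq → root-unique (trans (upto (≤-trans (≤-reflexive eq) z≤n)) eq)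
    ; parent      = parent′
    }
    where
    parent′ : ∀ {v k} → level′ v ≡ suc k → ∃ λ u → level′ u ≡ k
    parent′ {v} {k} eq with move v
    ... | low v≤i eq′    = parent-below {v} (trans (sym eq′) eq)
                             (≤-trans (ℕ.n≤1+n k) (subst (_≤ i) (trans (sym eq′) eq) v≤i))
    ... | kept _ top eq′ = parent-below {v} (trans top (trans (sym eq′) eq))
                             (≤-reflexive (ℕ.suc-injective (trans (sym eq) eq′)))
    -- A pushed node needs a predecessor on layer `i + 1`; any member of `S` serves, which is where
    -- nonemptiness enters.
    ... | pushed _ _ eq′ = proj₁ S-nonempty ,
                             trans (level′-kept (proj₂ S-nonempty)) (ℕ.suc-injective (trans (sym eq′) eq))

  agreement : Agreement (suc i) L refined
  agreement = record { root≡ = refl ; below = below ; upto = upto }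

  level′≤ : ∀ v → level′ v ≤ suc (suc i)
  level′≤ v with move v
  ... | low v≤i eq   = ≤-trans (≤-reflexive eq) (ℕ.m≤n⇒m≤1+n (ℕ.m≤n⇒m≤1+n v≤i))
  ... | kept _ _ eq  = ≤-trans (≤-reflexive eq) (ℕ.n≤1+n _)
  ... | pushed _ _ eq = ≤-reflexive eq

  level′-pushed : ∀ {u} → S u ≡ false → level u ≡ suc i → level′ u ≡ suc (suc i)
  level′-pushed {u} u∉S top = trans (cong (moved (level u)) u∉S) (moved-top top)

  S⁺ : ∀ {u} → level′ u ≡ suc i → S u ≡ true
  S⁺ {u} eq with move u
  ... | low u≤i eq′    = contradiction (subst (_≤ i) (trans (sym eq′) eq) u≤i) ℕ.1+n≰n
  ... | kept u∈S _ _   = u∈S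
  ... | pushed _ _ eq′ = contradiction (trans (sym eq) eq′) (ℕ.<⇒≢ (ℕ.n<1+n (suc i)))

-- Executions on layered networks.

module _ {M : Set} {n : ℕ} (P : Protocol M n) (σ : M) where
  open Protocol P
  open Layering

  private
    module E (L : Layering n) = Execution P (network L) σ

  -- If `unique` succeeds, then `incoming` is the singleton of the sender, and `incoming` is
  -- filtered by the edges into `v`.
  reception-edge : ∀ L acts {u v m} → E.reception L acts v ≡ just (u , m) → level L v ≡ suc (level L u)
  reception-edge L acts {u} {v} {m} eq with acts v
  ... | receive = All.head (subst (All (λ um → level L v ≡ suc (level L (proj₁ um))))
                                  (unique⁻ (E.incoming L acts v) eq)
                                  (mapMaybe-filter-All _ sender (allFin n)))
    where
    sender : ∀ {x y} → level L v ≡ suc (level L x) → Maybe.map (x ,_) (transmitted (acts x)) ≡ just y →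
             level L v ≡ suc (level L (proj₁ y))
    sender {x} x⟶v eq with just _ ← transmitted (acts x) | refl ← eq = x⟶v

  reception-silent : ∀ L acts v → unique (E.incoming L acts v) ≡ nothing → E.reception L acts v ≡ nothing
  reception-silent L acts v eq with acts v
  ... | receive    = eq
  ... | transmit _ = refl
  ... | inactive   = refl

  module _ {j} {L L′ : Layering n} (ag : Agreement j L L′) where
    open Agreement ag

    reception-cong : ∀ {acts acts′ v} → (∀ {u} → level L′ u ≤ j → acts′ u ≡ acts u) → level L′ v ≤ j →
                     E.reception L′ acts′ v ≡ E.reception L acts v
    reception-cong {acts} {acts′} {v} acts≡ v≤j = helper (acts≡ v≤j)
      (mapMaybe-filter-cong _ _ (λ {u} u⟶v → edge⁻ v≤j u⟶v ,
          cong (λ a → Maybe.map (u ,_) (transmitted a))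
               (acts≡ (sender≤ v≤j u⟶v)))
        (edge⁺ v≤j) (allFin n))
      where
      helper : acts′ v ≡ acts v → E.incoming L′ acts′ v ≡ E.incoming L acts v →
               E.reception L′ acts′ v ≡ E.reception L acts v
      helper act≡ inc≡ with acts′ v | acts v | act≡
      ... | receive    | _ | refl = cong unique inc≡
      ... | transmit _ | _ | refl = refl
      ... | inactive   | _ | refl = refl

    -- Simultaneous induction on the slot. Edges only lead upwards, so nodes on layers up to `j`
    -- cannot sense how the labels above are arranged; equal roots matter because the source acts
    -- with extra knowledge.
    history-agrees   : ∀ t {v} → level L′ v ≤ j → E.history L′ t v ≡ E.history L t v
    action-agrees    : ∀ t {v} → level L′ v ≤ j → E.action L′ t v ≡ E.action L t v
    reception-agrees : ∀ t {v} → level L′ v ≤ j →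
      E.reception L′ (E.action L′ t) v ≡ E.reception L (E.action L t) v

    history-agrees zero    v≤j = refl
    history-agrees (suc t) v≤j =
      cong₂ (λ r h → Maybe.map proj₂ r ∷ᵛ h) (reception-agrees t v≤j) (history-agrees t v≤j)

    action-agrees t {v} v≤j =
      cong₂ (λ s h → act v (if does (v ≟ s) then just σ else nothing) t h) root≡ (history-agrees t v≤j)

    reception-agrees t v≤j = reception-cong (action-agrees t) v≤j

  -- Delay of the source message and construction layer by layer.

  -- Layer h + 2 needs no bound before slot h Δ: by then layer h + 1, its only
  -- possible informant, is still uninformed.
  Silent : ℕ → Layering n → Set
  Silent Δ L = ∀ {t v h} → level L v ≡ suc (suc h) → h * Δ ≤ t → t < suc h * Δ →
               E.reception L (E.action L t) v ≡ nothing

  -- Layer `h + 2` learns only from layer `h + 1`, which is informed no earlier than `h * Δ`, and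
  -- `Silent` rules out the next `Δ` slots. `pred` appears because no delay is claimed for layer 1.
  informed-late : ∀ {Δ} L → Silent Δ L → ∀ {t v} → E.Informed L t v → pred (level L v) * Δ ≤ t
  informed-late L silent E.origin rewrite level-root L = z≤n
  informed-late L silent (E.retained inf) = ℕ.m≤n⇒m≤1+n (informed-late L silent inf)
  informed-late {Δ} L silent (E.received {t} {u} {v} inf rec)
    with late ← informed-late {Δ} L silent inf | u⟶v ← reception-edge L (E.action L t) rec
    rewrite u⟶v with level L u in eq
  ... | zero  = z≤n
  ... | suc h with suc h * Δ ℕ.≤? t
  ...   | yes h≤t = ℕ.m≤n⇒m≤1+n h≤t
  ...   | no  h≰t with () ← trans (sym rec) (silent u⟶v late (ℕ.≰⇒> h≰t))

  -- After `i` rounds, layers 0 to `i` are final and all other labels wait on layer `i + 1`; `free`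
  -- lists waiting labels that may still be selected.
  record Stage (Δ i c : ℕ) : Set where
    field
      layering   : Layering n
      level≤     : ∀ v → level layering v ≤ suc i
      silent     : Silent Δ layering
      free       : List (Fin n)
      free-uniq  : Unique free
      free-level : ∀ {u} → u ∈ free → level layering u ≡ suc i
      free-size  : c ≤ List.length free

  module _ {Δ k b : ℕ} (2^Δ<b^k : 2 ^ Δ < b ^ k) where

    module FreeBlocks {i c} (stage : Stage Δ i (k * b + c)) where
      open Stage stage

      node : Fin k → Fin b → Fin n
      node j x = lookup free (inject≤ (combine j x) (≤-trans (ℕ.m≤m+n (k * b) c) free-size))

      node-injective : ∀ {j j′ x x′} → node j x ≡ node j′ x′ → j ≡ j′ × x ≡ x′
      node-injective {j} {j′} {x} {x′} eq =
        combine-injective j x j′ x′ (inject≤-injective _ _ _ _ (lookup-injective free-uniq eq))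

      -- Behaviour of a label waiting on the top layer, in the window of `Δ` slots from `i * Δ`; by
      -- agreement it does not change if the label is kept there.
      transmits : Fin Δ → Fin n → Bool
      transmits s u = is-just (transmitted (E.action layering (i * Δ + toℕ s) u))

      open Selection node node-injective public

    -- `k * b` labels are held back to fill the blocks, and each round spends at most `k + k`. The
    -- selected set stays on layer `i + 1`; its even transmitter counts silence the new layer
    -- `i + 2` for one window.
    next-stage : ∀ {i c} → Stage Δ i (k * b + (k + k + c)) → Stage Δ (suc i) (k * b + c)
    next-stage {i} {c} stage
      with FreeBlocks.even-selection stage 2^Δ<b^k (FreeBlocks.transmits stage)
    ... | S , ys , length-ys , ys⊆free , S⊆ys , S-nonempty , even = record
      { layering   = refined
      ; level≤     = level′≤
      ; silent     = silent′
      ; free       = free without ys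
      ; free-uniq  = without-unique ys free-uniq
      ; free-level = free-level′
      ; free-size  = ℕ.+-cancelˡ-≤ (k + k) _ _ (begin
          k + k + (k * b + c)                        ≡⟨ swap (k + k) (k * b) c ⟩
          k * b + (k + k + c)                        ≤⟨ free-size ⟩
          List.length free                           ≤⟨ length-without ys free-uniq ⟩
          List.length ys + List.length (free without ys) ≡⟨ cong (_+ List.length (free without ys)) length-ys ⟩
          k + k + List.length (free without ys)      ∎)
      }
      where
      open Stage stage
      open ℕ.≤-Reasoning
      swap : ∀ x y z → x + (y + z) ≡ y + (x + z)
      swap = solve-∀

      ys-top : ∀ {u} → u ∈ ys → level layering u ≡ suc i
      ys-top u∈ys with _ , _ , refl ← All.lookup ys⊆free u∈ys = free-level (∈-lookup _)

      open Refinement layering level≤ S (ys-top ∘ S⊆ys _) S-nonempty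

      free-level′ : ∀ {u} → u ∈ free without ys → level′ u ≡ suc (suc i)
      free-level′ {u} u∈ with u∈free , u∉ys ← without⁻ ys u∈ =
        level′-pushed (Bool.¬-not (u∉ys ∘ S⊆ys u)) (free-level u∈free)

      -- The in-neighbours of `v` are exactly the members of `S`, which act as they did before the
      -- refinement, so `incoming` has even length.
      window : ∀ {t v} → level′ v ≡ suc (suc i) → (s : Fin Δ) → i * Δ + toℕ s ≡ t →
               E.reception refined (E.action refined t) v ≡ nothing
      window {t} {v} top s refl = reception-silent refined acts v (unique-even (E.incoming refined acts v)
        (trans (parity-mapMaybe-filter _ _ (allFin n)) (trans (parity-cong (allFin n) pointwise) (even s))))
        where
        acts : Fin n → Action M
        acts = E.action refined t

        pointwise : ∀ u → does (level′ v ℕ.≟ suc (level′ u)) ∧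
            is-just (Maybe.map (u ,_) (transmitted (acts u)))
          ≡ S u ∧ is-just (transmitted (E.action layering t u))
        pointwise u = by-cases (S u) refl
          where
          by-cases : ∀ x → S u ≡ x → does (level′ v ℕ.≟ suc (level′ u)) ∧
              is-just (Maybe.map (u ,_) (transmitted (acts u)))
            ≡ x ∧ is-just (transmitted (E.action layering t u))
          by-cases true u∈S = cong₂ _∧_
            (dec-true (level′ v ℕ.≟ suc (level′ u)) (trans top (cong suc (sym (level′-kept u∈S)))))
            (trans (is-just-map (transmitted (acts u)))
              (cong (is-just ∘ transmitted) (action-agrees agreement t (≤-reflexive (level′-kept u∈S)))))
          by-cases false u∉S = cong (_∧ is-just (Maybe.map (u ,_) (transmitted (acts u))))
            (dec-false (level′ v ℕ.≟ suc (level′ u)) (λ v≡1+u → contradiction (trans (sym (S⁺ (ℕ.suc-injective (trans (sym v≡1+u) top)))) u∉S) λ ()))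

      silent′ : Silent Δ refined
      silent′ {t} {v} {h} eq lo hi with h ℕ.≟ i
      -- Layers up to `i + 1` inherit their silence by agreement; only the new layer `i + 2` needs
      -- `window`.
      ... | no h≢i = trans (reception-agrees agreement t v≤) (silent (trans (upto v≤) eq) lo hi)
        where
        v≤ : level′ v ≤ suc i
        v≤ = subst (_≤ suc i) (sym eq)
          (s≤s (ℕ.≤∧≢⇒< (s≤s⁻¹ (s≤s⁻¹ (subst (_≤ suc (suc i)) eq (level′≤ v)))) h≢i))
      ... | yes refl = window eq (fromℕ< lt) (trans (cong (i * Δ +_) (toℕ-fromℕ< lt)) (ℕ.m+[n∸m]≡n lo))
        where
        lt : t ∸ i * Δ < Δ
        lt = ℕ.+-cancelˡ-< (i * Δ) _ _ (subst₂ _<_ (sym (ℕ.m+[n∸m]≡n lo)) (ℕ.+-comm Δ (i * Δ)) hi)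

    -- `r` counts the rounds still to come, whose labels must survive the first `i` rounds.
    stages : ∀ i r → Stage Δ 0 (k * b + (i + r) * (k + k)) → Stage Δ i (k * b + r * (k + k))
    stages zero    r stage = stage
    stages (suc i) r stage = next-stage (stages i (suc r)
      (subst (λ m → Stage Δ 0 (k * b + m * (k + k))) (sym (ℕ.+-suc i r)) stage))

  -- The root is alone on layer 0 and all other nodes are on layer 1; silence is vacuous without a
  -- layer 2.
  start : ∀ {n′} → n ≡ suc n′ → ∀ Δ {c} → c ≤ n′ → Stage Δ 0 c
  start {n′} refl Δ c≤n′ = record
    { layering   = layering
    ; level≤     = level₀≤1
    ; silent     = λ {_} {v} eq → contradiction (≤-trans (≤-reflexive (sym eq)) (level₀≤1 v)) λ where (s≤s ())
    ; free       = tabulate suc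
    ; free-uniq  = Unique.tabulate⁺ Fin.suc-injective
    ; free-level = All.lookup (All.tabulate⁺ {P = λ u → level₀ u ≡ 1} (λ _ → refl))
    ; free-size  = ≤-trans c≤n′ (≤-reflexive (sym (length-tabulate suc)))
    }
    where
    level₀ : Fin (suc n′) → ℕ
    level₀ zero    = 0
    level₀ (suc _) = 1

    level₀≤1 : ∀ v → level₀ v ≤ 1
    level₀≤1 zero    = z≤n
    level₀≤1 (suc _) = s≤s z≤n

    root-unique₀ : ∀ {v} → level₀ v ≡ 0 → v ≡ zero
    root-unique₀ {zero} _ = refl

    parent₀ : ∀ {v h} → level₀ v ≡ suc h → ∃ λ u → level₀ u ≡ h
    parent₀ {suc _} refl = zero , refl

    layering : Layering (suc n′)
    layering = record
      { root        = zero
      ; level       = level₀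
      ; level-root  = refl
      ; root-unique = root-unique₀
      ; parent      = parent₀
      }

  -- After `d` rounds the `k * b` reserved labels remain, so layer `d + 1` is inhabited, and it is
  -- informed no earlier than `d * Δ`.
  hard-network : ∀ {Δ k b d} → 2 ^ Δ < b ^ k → 0 < k * b → k * b + d * (k + k) < n →
    Σ[ N ∈ Network n ] MaxEccentricity (Network.graph N) (suc d) ×
      (∀ T → T < d * Δ → ¬ Execution.CompletedWithin P N σ T)
  hard-network {Δ} {k} {b} {d} 2^Δ<b^k 0<kb kb+2dk<n = network layering , maxEccentricity layering level≤ top , late
    where
    stage : Stage Δ d (k * b + 0)
    stage = stages {Δ} {k} {b} 2^Δ<b^k d 0 (start (sym (ℕ.suc-pred n {{>-nonZero (≤-trans (s≤s z≤n) kb+2dk<n)}}))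
      Δ (subst (λ m → k * b + m * (k + k) ≤ pred n) (sym (ℕ.+-identityʳ d)) (ℕ.<⇒≤pred kb+2dk<n)))

    open Stage stage

    top : ∃ λ v → level layering v ≡ suc d
    top = lookup free i , free-level (∈-lookup i)
      where
      i : Fin (List.length free)
      i = fromℕ< (≤-trans 0<kb (≤-trans (ℕ.m≤m+n (k * b) 0) free-size))

    late : ∀ T → T < d * Δ → ¬ E.CompletedWithin layering T
    late T T<dΔ done = ℕ.<⇒≱ T<dΔ (subst (λ l → pred l * Δ ≤ T) (proj₂ top)
      (informed-late {Δ} layering silent (done (proj₁ top) (Network.isSource (network layering) (proj₁ top)))))

-- Choice of the parameters.

log₂-bounds : ∀ d → ∃ λ ℓ → 2 ^ ℓ ≤ suc d × suc d < 2 ^ suc ℓ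
log₂-bounds zero = 0 , s≤s z≤n , s≤s (s≤s z≤n)
log₂-bounds (suc d) with ℓ , lo , hi ← log₂-bounds d with suc (suc d) ℕ.<? 2 ^ suc ℓ
... | yes hi′ = ℓ , ℕ.m≤n⇒m≤1+n lo , hi′
... | no ¬hi′ = suc ℓ , ℕ.≮⇒≥ ¬hi′ ,
  ≤-trans (s≤s hi) (ℕ.^-monoʳ-< 2 (s≤s (s≤s z≤n)) (ℕ.n<1+n (suc ℓ)))

-- `k` is the quotient `n / m`. As it is positive, the remainder is below `m ≤ k * m`, whence the
-- factor 2.
block-count : ∀ {n m} .{{_ : NonZero m}} → m ≤ n → ∃ λ k → 0 < k × k * m ≤ n × n ≤ 2 * k * m
block-count {n} {m} m≤n = n / m , 0<k , m/n*n≤m n m , (begin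
  n                     ≡⟨ m≡m%n+[m/n]*n n m ⟩
  n % m + n / m * m     ≤⟨ ℕ.+-monoˡ-≤ _ (ℕ.<⇒≤ (m%n<n n m)) ⟩
  m + n / m * m         ≤⟨ ℕ.+-monoˡ-≤ _ (ℕ.m≤n*m m (n / m) {{>-nonZero 0<k}}) ⟩
  n / m * m + n / m * m ≡⟨ double (n / m) m ⟩
  2 * (n / m) * m       ∎)
  where
  open ℕ.≤-Reasoning
  0<k : 0 < n / m
  0<k = m≥n⇒m/n>0 m≤n
  double : ∀ x y → x * y + x * y ≡ 2 * x * y
  double = solve-∀

-- For `D = suc d` at least 2, `log₂ D < ℓ + 1 ≤ 2 ℓ` and `D ≤ 2 (D - 1)`; with `n ≤ 8 k D` the
-- factors multiply to 32. For `D = 1` the left side is 1.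
delay-bound : ∀ d {n k ℓ} → n ≤ 2 * k * (4 * suc d) → suc d < 2 ^ suc ℓ → suc d ^ n ≤ 2 ^ (32 * (d * (k * ℓ)))
delay-bound zero {n} n≤ hi rewrite ℕ.^-zeroˡ n = s≤s z≤n
delay-bound (suc d) {ℓ = zero} n≤ (s≤s (s≤s ()))
delay-bound d′@(suc d) {n} {k} {ℓ@(suc ℓ′)} n≤ hi = begin
  suc d′ ^ n                       ≤⟨ ℕ.^-monoˡ-≤ n (ℕ.<⇒≤ hi) ⟩
  (2 ^ suc ℓ) ^ n                  ≡⟨ ℕ.^-*-assoc 2 (suc ℓ) n ⟩
  2 ^ (suc ℓ * n)                  ≤⟨ ℕ.^-monoʳ-≤ 2 (begin
    suc ℓ * n                        ≤⟨ ℕ.*-mono-≤ (1+x≤2x ℓ′) n≤ ⟩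
    2 * ℓ * (2 * k * (4 * suc d′))   ≤⟨ ℕ.*-monoʳ-≤ (2 * ℓ) (ℕ.*-monoʳ-≤ (2 * k) (ℕ.*-monoʳ-≤ 4 (1+x≤2x d))) ⟩
    2 * ℓ * (2 * k * (4 * (2 * d′))) ≡⟨ rearrange ℓ k d′ ⟩
    32 * (d′ * (k * ℓ))              ∎) ⟩
  2 ^ (32 * (d′ * (k * ℓ)))        ∎
  where
  open ℕ.≤-Reasoning
  1+x≤2x : ∀ x → suc (suc x) ≤ 2 * suc x
  1+x≤2x x = ℕ.+-mono-≤ (s≤s z≤n) (≤-reflexive (sym (ℕ.+-identityʳ (suc x))))
  rearrange : ∀ ℓ k d → 2 * ℓ * (2 * k * (4 * (2 * d))) ≡ 32 * (d * (k * ℓ))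
  rearrange = solve-∀

-- `2 ^ ℓ ≤ D`, and the factor 2 in the block size `2 D` gives strictness.
enough-selections : ∀ {d k ℓ} → 2 ^ ℓ ≤ suc d → 0 < k → 2 ^ (k * ℓ) < (2 * suc d) ^ k
enough-selections {d} {k} {ℓ} lo 0<k = begin-strict
  2 ^ (k * ℓ)      ≡⟨ cong (2 ^_) (ℕ.*-comm k ℓ) ⟩
  2 ^ (ℓ * k)      ≡⟨ ℕ.^-*-assoc 2 ℓ k ⟨
  (2 ^ ℓ) ^ k      ≤⟨ ℕ.^-monoˡ-≤ k lo ⟩
  suc d ^ k        <⟨ ℕ.^-monoˡ-< k {{>-nonZero 0<k}} (ℕ.m<m+n (suc d) (s≤s z≤n)) ⟩
  (2 * suc d) ^ k  ∎
  where open ℕ.≤-Reasoning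

-- `2 D k` reserved labels and `2 k` for each of `D - 1` rounds total less than `4 D k`; strictness
-- leaves room for the root.
enough-nodes : ∀ {d k n} → 0 < k → k * (4 * suc d) ≤ n → k * (2 * suc d) + d * (k + k) < n
enough-nodes {d} {k} {n} 0<k 4Dk≤n = begin-strict
  k * (2 * suc d) + d * (k + k)      <⟨ ℕ.+-monoʳ-< (k * (2 * suc d)) (ℕ.m<n+m (d * (k + k)) (ℕ.m≤n⇒m≤n+o k 0<k)) ⟩
  k * (2 * suc d) + suc d * (k + k)  ≡⟨ rearrange k (suc d) ⟩
  k * (4 * suc d)                    ≤⟨ 4Dk≤n ⟩
  n                                  ∎
  where
  open ℕ.≤-Reasoning
  rearrange : ∀ k D → k * (2 * D) + D * (k + k) ≡ k * (4 * D)
  rearrange = solve-∀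

theorem4p1 : ∃[ a ] (0ℚ <ℚ a) ×
    (∀ (n D : ℕ) → 1 ≤ D → 6 * D ≤ n →
    ∀ (M : Set) (P : Protocol M n) (σ : M) →
    Σ[ N ∈ Network n ]
    MaxEccentricity (Network.graph N) D ×
    (∀ (T : ℕ) → T < a · n ·log₂ D → ¬ Execution.CompletedWithin P N σ T))
theorem4p1 = 1/32 , ℚ.*<* (ℤ.+<+ (s≤s z≤n)) , bound
  where
  1/32 : ℚ
  -- 32 is the factor lost in `delay-bound`; the second field stores the denominator minus one.
  1/32 = mkℚ (ℤ.+ 1) 31 (1-coprimeTo 32)

  bound : ∀ (n D : ℕ) → 1 ≤ D → 6 * D ≤ n → ∀ (M : Set) (P : Protocol M n) (σ : M) →
    Σ[ N ∈ Network n ] MaxEccentricity (Network.graph N) D ×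
      (∀ (T : ℕ) → T < 1/32 · n ·log₂ D → ¬ Execution.CompletedWithin P N σ T)
  bound n D@(suc d) _ 6D≤n M P σ =
    let ℓ , lo , hi             = log₂-bounds d
        -- `k` is the quotient of `n` by `4 D`, positive because `4 D ≤ 6 D ≤ n`.
        k , 0<k , 4Dk≤n , n≤8Dk = block-count (≤-trans (ℕ.*-monoˡ-≤ D {4} {6} (ℕ.m≤m+n 4 2)) 6D≤n)
        N , ecc , late          = hard-network P σ {k * ℓ} {k} {2 * D} {d} (enough-selections lo 0<k)
                                  (ℕ.*-mono-≤ 0<k (s≤s z≤n)) (enough-nodes 0<k 4Dk≤n)
    in N , ecc , λ T T<anlogD → late T (ℕ.≰⇒> λ dkℓ≤T → ℕ.<⇒≱ T<anlogD (begin
      D ^ (1 * n)               ≡⟨ cong (D ^_) (ℕ.*-identityˡ n) ⟩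
      D ^ n                     ≤⟨ delay-bound d {k = k} n≤8Dk hi ⟩
      2 ^ (32 * (d * (k * ℓ)))  ≤⟨ ℕ.^-monoʳ-≤ 2 (ℕ.*-monoʳ-≤ 32 dkℓ≤T) ⟩
      2 ^ (32 * T)              ∎))
    where open ℕ.≤-Reasoning
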